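{- Let $r\ge 3$ be an integer and $\mathcal{A}_r=\{0,1,2^r,2^r+2\}$. Then $\phi_{\mathcal{A}_r}(x)=1+x+x^{2^r}+x^{2^r+2}$, and the sequence $\left(f_{\mathcal{A}_r}(n)\right)_{n\ge 0}$ modulo $2$ is periodic with least period dividing $4^r+2^r+1$. Among any $4^r+2^r+1$ consecutive terms of $\left(f_{\mathcal{A}_r}(n)\right)_{n\ge0}$, exactly $4^r-3^r+2^r$ terms are odd and $3^r+1$ terms are even.
   Context: For a finite set $\mathcal{A}$ of non-negative integers containing $0$, $f_{\mathcal{A}}(n)$ denotes the number of ways to write the non-negative integer $n$ in the form $n=\sum_{i=0}^{\infty}\epsilon_i2^i$ with every $\epsilon_i\in\mathcal{A}$ (so all but finitely many $\epsilon_i$ are $0$), and $\phi_{\mathcal{A}}(x)=\sum_{a\in\mathcal{A}}x^a\in\mathbb{F}_2[x]$. -}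

module Defs where

open import Data.Fin.Base using (Fin; zero; suc)
open import Data.List.Base
  using (List; []; _∷_; applyUpTo; cartesianProductWith; filter; foldr; length; lookup; map)
open import Data.List.Membership.Propositional using (_∈_)
open import Data.List.Membership.Propositional.Properties
  using (∈-cartesianProductWith⁺; ∈-cartesianProductWith⁻; ∈-filter⁺; ∈-filter⁻; ∈-lookup)
open import Data.List.Relation.Unary.All as All using (All)
open import Data.List.Relation.Unary.AllPairs using ([]; _∷_)
open import Data.List.Relation.Unary.Any using (here; there; index)
open import Data.List.Relation.Unary.Any.Properties using (lookup-index)
open import Data.List.Relation.Unary.Unique.Propositional using (Unique)
open import Data.List.Relation.Unary.Unique.Propositional.Properties
  using (cartesianProductWith⁺; filter⁺)
open import Data.Nat.Base
open import Data.Nat.ListAction using (sum)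
open import Data.Nat.Properties
open import Data.Parity.Base as ℙ using (Parity; 0ℙ; 1ℙ)
open import Data.Product.Base using (∃-syntax; _×_; _,_; proj₁; proj₂)
open import Data.Vec.Base as Vec using (Vec; []; _∷_)
import Data.Vec.Properties as Vec
open import Function.Base using (_∘_)
open import Function.Bundles using (Inverse)
open import Level using (0ℓ)
open import Relation.Binary.Bundles using (Setoid)
open import Relation.Binary.PropositionalEquality
  using (_≡_; _≗_; refl; sym; trans; cong; cong₂; subst; setoid)
open import Relation.Nullary using (contradiction; yes; no)

record DigitSet : Set where
  field
    elements : List ℕ
    distinct : Unique elements
    0∈       : 0 ∈ elements

open DigitSet public

Σ[_<_] : (ℕ → ℕ) → ℕ → ℕ
Σ[ g < k ] = sum (applyUpTo g k)

VanishesFrom : (ℕ → ℕ) → ℕ → Set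
VanishesFrom g k = ∀ i → k ≤ i → g i ≡ 0

record Representation (A : DigitSet) (n : ℕ) : Set where
  field
    ε      : ℕ → ℕ
    ε∈     : ∀ i → ε i ∈ elements A
    -- Σᵢ εᵢ 2ⁱ = n: since ε is eventually zero, the infinite sum is any
    -- sufficiently long partial sum.
    sums-to : ∃[ k ] VanishesFrom ε k × Σ[ (λ i → ε i * 2 ^ i) < k ] ≡ n

open Representation public

-- Two representations are the same when their digits are: the choice of the
-- bound k and of the membership proofs is irrelevant.
representations : DigitSet → ℕ → Setoid 0ℓ 0ℓ
representations A n = record
  { Carrier       = Representation A n
  ; _≈_           = λ R S → ε R ≗ ε S
  ; isEquivalence = record
    { refl  = λ i → refl
    ; sym   = λ p i → sym (p i)
    ; trans = λ p q i → trans (p i) (q i)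
    }
  }

record Finite (S : Setoid 0ℓ 0ℓ) : Set where
  field
    size        : ℕ
    enumeration : Inverse (setoid (Fin size)) S

------------------------------------------------------------------------
-- Finiteness of the set of representations of n.  As n < 2ⁿ, only the
-- digits in positions below n can be nonzero.

at : ∀ {k} → Vec ℕ k → ℕ → ℕ
at []      _       = 0
at (x ∷ v) zero    = x
at (x ∷ v) (suc i) = at v i

prefix : (ℕ → ℕ) → ∀ k → Vec ℕ k
prefix ε zero    = []
prefix ε (suc k) = ε 0 ∷ prefix (ε ∘ suc) k

words : List ℕ → ∀ k → List (Vec ℕ k)
words xs zero    = [] ∷ []
words xs (suc k) = cartesianProductWith _∷_ xs (words xs k)

words-unique : ∀ {xs} → Unique xs → ∀ k → Unique (words xs k)
words-unique u zero    = All.[] ∷ []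
words-unique u (suc k) = cartesianProductWith⁺ _∷_ Vec.∷-injective u (words-unique u k)

at-vanishes : ∀ {k} (v : Vec ℕ k) → VanishesFrom (at v) k
at-vanishes []      i       _         = refl
at-vanishes (x ∷ v) (suc i) (s≤s k≤i) = at-vanishes v i k≤i

at-∈ : ∀ {xs} → 0 ∈ xs → ∀ k {v} → v ∈ words xs k → ∀ i → at v i ∈ xs
at-∈ 0∈xs zero    (here refl) i = 0∈xs
at-∈ {xs} 0∈xs (suc k) v∈ i with ∈-cartesianProductWith⁻ _∷_ xs (words xs k) v∈
at-∈ 0∈xs (suc k) v∈ zero    | a , w , a∈ , w∈ , refl = a∈
at-∈ 0∈xs (suc k) v∈ (suc i) | a , w , a∈ , w∈ , refl = at-∈ 0∈xs k w∈ i

prefix-∈ : ∀ {xs} {e : ℕ → ℕ} → (∀ i → e i ∈ xs) → ∀ k → prefix e k ∈ words xs k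
prefix-∈ e∈ zero    = here refl
prefix-∈ e∈ (suc k) = ∈-cartesianProductWith⁺ _∷_ (e∈ 0) (prefix-∈ (e∈ ∘ suc) k)

prefix-cong : ∀ {d e} → d ≗ e → ∀ k → prefix d k ≡ prefix e k
prefix-cong d≗e zero    = refl
prefix-cong d≗e (suc k) = cong₂ _∷_ (d≗e 0) (prefix-cong (d≗e ∘ suc) k)

prefix-at : ∀ {k} (v : Vec ℕ k) → prefix (at v) k ≡ v
prefix-at []      = refl
prefix-at (x ∷ v) = cong (x ∷_) (prefix-at v)

at-prefix : ∀ k {e} → VanishesFrom e k → at (prefix e k) ≗ e
at-prefix zero    e≡0 i       = sym (e≡0 i z≤n)
at-prefix (suc k) e≡0 zero    = refl
at-prefix (suc k) e≡0 (suc i) = at-prefix k (λ j k≤j → e≡0 (suc j) (s≤s k≤j)) i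

Σ-cong : ∀ {g h} → g ≗ h → ∀ k → Σ[ g < k ] ≡ Σ[ h < k ]
Σ-cong g≗h zero    = refl
Σ-cong g≗h (suc k) = cong₂ _+_ (g≗h 0) (Σ-cong (g≗h ∘ suc) k)

Σ-stable : ∀ {g} k l → VanishesFrom g k → VanishesFrom g l → Σ[ g < k ] ≡ Σ[ g < l ]
Σ-stable zero    zero    p q = refl
Σ-stable zero    (suc l) p q =
  sym (cong₂ _+_ (p 0 z≤n)
    (sym (Σ-stable zero l (λ i _ → p (suc i) z≤n) (λ i l≤i → q (suc i) (s≤s l≤i)))))
Σ-stable (suc k) zero    p q =
  cong₂ _+_ (q 0 z≤n)
    (Σ-stable k zero (λ i k≤i → p (suc i) (s≤s k≤i)) (λ i _ → q (suc i) z≤n))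
Σ-stable {g} (suc k) (suc l) p q =
  cong (g 0 +_) (Σ-stable k l (λ i k≤i → p (suc i) (s≤s k≤i)) (λ i l≤i → q (suc i) (s≤s l≤i)))

term≤Σ : ∀ g k {i} → i < k → g i ≤ Σ[ g < k ]
term≤Σ g (suc k) {zero}  _         = m≤m+n (g 0) _
term≤Σ g (suc k) {suc i} (s≤s i<k) = ≤-trans (term≤Σ (g ∘ suc) k i<k) (m≤n+m _ (g 0))

n<2^n : ∀ n → n < 2 ^ n
n<2^n zero    = s≤s z≤n
n<2^n (suc n) = +-mono-≤ (m^n>0 2 n) (≤-trans (n<2^n n) (m≤m+n (2 ^ n) 0))

m*k<k⇒m≡0 : ∀ m {k} → m * k < k → m ≡ 0
m*k<k⇒m≡0 zero        _   = refl
m*k<k⇒m≡0 (suc m) {k} m*k = contradiction (m≤m+n k (m * k)) (<⇒≱ m*k)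

lookup-injective : ∀ {B : Set} {xs : List B} → Unique xs →
                   ∀ i j → lookup xs i ≡ lookup xs j → i ≡ j
lookup-injective (x∉ ∷ u) zero    zero    eq = refl
lookup-injective (x∉ ∷ u) zero    (suc j) eq = contradiction eq (All.lookup x∉ (∈-lookup j))
lookup-injective (x∉ ∷ u) (suc i) zero    eq = contradiction (sym eq) (All.lookup x∉ (∈-lookup i))
lookup-injective (x∉ ∷ u) (suc i) (suc j) eq = cong suc (lookup-injective u i j eq)

module _ {A : DigitSet} {n : ℕ} (R : Representation A n) where

  private
    k     = proj₁ (sums-to R)
    ε≡0   = proj₁ (proj₂ (sums-to R))
    Σk≡n  = proj₂ (proj₂ (sums-to R))

    term : ℕ → ℕ
    term i = ε R i * 2 ^ i

  ε-vanishes : VanishesFrom (ε R) n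
  ε-vanishes i n≤i with k ≤? i
  ... | yes k≤i = ε≡0 i k≤i
  ... | no  k≰i = m*k<k⇒m≡0 (ε R i)
    (≤-<-trans (subst (term i ≤_) Σk≡n (term≤Σ term k (≰⇒> k≰i)))
      (<-≤-trans (n<2^n n) (^-monoʳ-≤ 2 n≤i)))

  Σ-ε≡n : Σ[ term < n ] ≡ n
  Σ-ε≡n = trans
    (Σ-stable n k (λ i n≤i → cong (_* 2 ^ i) (ε-vanishes i n≤i))
                  (λ i k≤i → cong (_* 2 ^ i) (ε≡0 i k≤i)))
    Σk≡n

module _ (A : DigitSet) (n : ℕ) where

  value : Vec ℕ n → ℕ
  value v = Σ[ (λ i → at v i * 2 ^ i) < n ]

  solutions : List (Vec ℕ n)
  solutions = filter (λ v → value v ≟ n) (words (elements A) n)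

  solutions-unique : Unique solutions
  solutions-unique = filter⁺ (λ v → value v ≟ n) (words-unique (distinct A) n)

  fromWord : ∀ {v} → v ∈ solutions → Representation A n
  fromWord {v} v∈ = record
    { ε       = at v
    ; ε∈      = at-∈ (0∈ A) n (proj₁ v∈′)
    ; sums-to = n , at-vanishes v , proj₂ v∈′
    }
    where v∈′ = ∈-filter⁻ (λ v → value v ≟ n) {xs = words (elements A) n} v∈

  toWord : Representation A n → Vec ℕ n
  toWord R = prefix (ε R) n

  at-toWord : ∀ R → at (toWord R) ≗ ε R
  at-toWord R = at-prefix n (ε-vanishes R)

  toWord-∈ : ∀ R → toWord R ∈ solutions
  toWord-∈ R = ∈-filter⁺ (λ v → value v ≟ n) (prefix-∈ (ε∈ R) n)
    (trans (Σ-cong (λ i → cong (_* 2 ^ i) (at-toWord R i)) n) (Σ-ε≡n R))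

  position : Representation A n → Fin (length solutions)
  position R = index (toWord-∈ R)

  position-unique : ∀ R i → ε R ≗ at (lookup solutions i) → position R ≡ i
  position-unique R i R≈ = lookup-injective solutions-unique (position R) i
    (trans (sym (lookup-index (toWord-∈ R)))
      (trans (prefix-cong R≈ n) (prefix-at (lookup solutions i))))

  at-position : ∀ R → at (lookup solutions (position R)) ≗ ε R
  at-position R i = trans (cong (λ v → at v i) (sym (lookup-index (toWord-∈ R)))) (at-toWord R i)

  representations-finite : Finite (representations A n)
  representations-finite = record
    { size        = length solutions
    ; enumeration = record
      { to        = λ i → fromWord (∈-lookup {xs = solutions} i)
      ; from      = position
      ; to-cong   = λ { refl i → refl }
      ; from-cong = λ {R} {S} R≈S →
          position-unique R (position S) (λ i → trans (R≈S i) (sym (at-position S i)))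
      ; inverse   = (λ { {R} refl → at-position R }) , (λ {i} {R} → position-unique R i)
      }
    }

f : DigitSet → ℕ → ℕ
f A n = Finite.size (representations-finite A n)

------------------------------------------------------------------------
-- 𝔽₂[X]: coefficient lists, constant term first, possibly with trailing
-- zeros.  The field 𝔽₂ is Parity.

infix  4 _≈ₚ_
infixl 6 _+ₚ_
infixl 7 _*ₚ_
infixr 8 _^ₚ_

𝔽₂[X] : Set
𝔽₂[X] = List Parity

coeff : 𝔽₂[X] → ℕ → Parity
coeff []      _       = 0ℙ
coeff (a ∷ p) zero    = a
coeff (a ∷ p) (suc i) = coeff p i

_≈ₚ_ : 𝔽₂[X] → 𝔽₂[X] → Set
p ≈ₚ q = coeff p ≗ coeff q

0ₚ 1ₚ X : 𝔽₂[X]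
0ₚ = []
1ₚ = 1ℙ ∷ []
X  = 0ℙ ∷ 1ℙ ∷ []

_+ₚ_ : 𝔽₂[X] → 𝔽₂[X] → 𝔽₂[X]
[]      +ₚ q       = q
(a ∷ p) +ₚ []      = a ∷ p
(a ∷ p) +ₚ (b ∷ q) = (a ℙ.+ b) ∷ (p +ₚ q)

_*ₚ_ : 𝔽₂[X] → 𝔽₂[X] → 𝔽₂[X]
[]      *ₚ q = []
(a ∷ p) *ₚ q = map (a ℙ.*_) q +ₚ (0ℙ ∷ p *ₚ q)

_^ₚ_ : 𝔽₂[X] → ℕ → 𝔽₂[X]
p ^ₚ zero  = 1ₚ
p ^ₚ suc n = p *ₚ p ^ₚ n

φ : DigitSet → 𝔽₂[X]
φ A = foldr (λ a p → X ^ₚ a +ₚ p) 0ₚ (elements A)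

------------------------------------------------------------------------

𝒜 : (r : ℕ) → 3 ≤ r → DigitSet
𝒜 r 3≤r = record
  { elements = 0 ∷ 1 ∷ 2 ^ r ∷ 2 ^ r + 2 ∷ []
  ; distinct = ((λ ()) All.∷ <⇒≢ (<-trans (s≤s z≤n) 1<2^r)
                       All.∷ <⇒≢ (<-trans (s≤s z≤n) 1<2^r+2) All.∷ All.[])
             ∷ (<⇒≢ 1<2^r All.∷ <⇒≢ 1<2^r+2 All.∷ All.[])
             ∷ (<⇒≢ 2^r<2^r+2 All.∷ All.[])
             ∷ All.[]
             ∷ []
  ; 0∈       = here refl
  }
  where
  1<2^r : 1 < 2 ^ r
  1<2^r = ≤-trans (s≤s (s≤s z≤n)) (^-monoʳ-≤ 2 3≤r)

  2^r<2^r+2 : 2 ^ r < 2 ^ r + 2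
  2^r<2^r+2 = m<m+n (2 ^ r) (s≤s z≤n)

  1<2^r+2 : 1 < 2 ^ r + 2
  1<2^r+2 = <-trans 1<2^r 2^r<2^r+2

-- Periodic from index 0 on, not just eventually.
IsPeriod : (ℕ → ℕ) → ℕ → Set
IsPeriod s p = 0 < p × (∀ n → s (n + p) ≡ s n)

IsLeastPeriod : (ℕ → ℕ) → ℕ → Set
IsLeastPeriod s p = IsPeriod s p × (∀ q → IsPeriod s q → p ≤ q)

consecutive : (ℕ → ℕ) → ℕ → ℕ → List ℕ
consecutive s m k = applyUpTo (λ i → s (m + i)) k

{-# OPTIONS --safe #-}
module Submission where

-- Modulo 2 the generating function F of f satisfies F(x) = φ(x) F(x²) = φ(x) F(x)², so φ F = 1.
-- With q = 2 ^ r we have φ = (1 + x)(1 + x^q + x^(q+1)), hence f(n) + f(n-q) + f(n-q-1) is always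
-- odd.  So b = 1 + f mod 2 vanishes below q, has b(q) = 1, and b(n+q+1) = b(n+1) + b(n): cut into
-- rows of length q, b is Pascal's triangle, b((k+1)q + j) = C(k,j) mod 2 for k ≤ q and j < q.
-- Because C(q,j) is even for 0 < j < q, b starts again at N = q² + q + 1.  No smaller shift is a
-- period, since b starts with q zeros but is 1 at every multiple of q from q to N - 1.  The even
-- terms of f in one period are the 3^r odd entries of the first q rows and the one at N - 1.

open import Defs
open import Algebra.Properties.CommutativeSemigroup using (interchange)
open import Data.List.Base
  using (List; []; _∷_; _++_; applyUpTo; cartesianProductWith; filter; length; map)
open import Data.List.Properties using (filter-++; filter-none; filter-≐; length-++; length-applyUpTo)
import Data.List.Relation.Unary.All as All
open import Data.Nat.Base
  using (ℕ; zero; suc; _≤_; _<_; z≤n; s≤s; pred; _+_; _*_; _∸_; _^_; _%_; _/_; parity)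
open import Data.Nat.Combinatorics using (_C_; k>n⇒nCk≡0; nCn≡1; nCk+nC[k+1]≡[n+1]C[k+1])
open import Data.Nat.Divisibility using (_∣_; _∣?_; ∣-refl; m%n≡0⇒n∣m; n∣m⇒m%n≡0)
open import Data.Nat.DivMod using (m≡m%n+[m/n]*n; m%n<n; m<n*o⇒m/o<n)
open import Data.Nat.Induction using (<-rec)
open import Data.Nat.ListAction using (sum)
open import Data.Nat.Properties
open import Data.Nat.Tactic.RingSolver using (solve-∀)
open import Data.Parity.Base as ℙ using (Parity; 0ℙ; 1ℙ; _⁻¹)
import Data.Parity.Properties as ℙ
open import Data.Product.Base using (_×_; _,_; ∃-syntax)
open import Data.Vec.Base using (Vec; _∷_)
open import Function.Base using (_∘_)
open import Level using (0ℓ)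
open import Relation.Binary.Definitions using (tri<; tri≈; tri>)
open import Relation.Binary.PropositionalEquality
  using (_≡_; _≢_; refl; sym; trans; cong; cong₂; subst; module ≡-Reasoning)
open import Relation.Nullary using (contradiction; yes; no; ¬_)
open import Relation.Nullary.Decidable using (¬?)
open import Relation.Unary using (Decidable; Pred; _≐_)

open ≡-Reasoning

-- Doubling

-- A recursion of its own, not `2 * n`, so that two successors come off at each step: the inductions
-- on `delay` then run by computation, and `Halved` can be indexed by it.
double : ℕ → ℕ
double zero    = zero
double (suc n) = suc (suc (double n))

double≡n+n : ∀ n → double n ≡ n + n
double≡n+n zero    = refl
double≡n+n (suc n) = cong suc (trans (cong suc (double≡n+n n)) (sym (+-suc n n)))

double≡2*n : ∀ n → double n ≡ 2 * n
double≡2*n n = trans (double≡n+n n) (cong (n +_) (sym (+-identityʳ n)))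

double-+ : ∀ m n → double m + double n ≡ double (m + n)
double-+ zero    n = refl
double-+ (suc m) n = cong (suc ∘ suc) (double-+ m n)

double-injective : ∀ {m n} → double m ≡ double n → m ≡ n
double-injective {zero}  {zero}  _  = refl
double-injective {suc m} {suc n} eq = cong suc (double-injective (suc-injective (suc-injective eq)))

double≢suc-double : ∀ m n → double m ≢ suc (double n)
double≢suc-double (suc m) (suc n) eq =
  double≢suc-double m n (suc-injective (suc-injective eq))

n≤double : ∀ n → n ≤ double n
n≤double zero    = z≤n
n≤double (suc n) = s≤s (m≤n⇒m≤1+n (n≤double n))

double-mono : ∀ {m n} → m ≤ n → double m ≤ double n
double-mono z≤n       = z≤n
double-mono (s≤s m≤n) = s≤s (s≤s (double-mono m≤n))

data Halved : ℕ → Set where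
  even : ∀ m → Halved (double m)
  odd  : ∀ m → Halved (suc (double m))

halve : ∀ n → Halved n
halve zero    = even zero
halve (suc n) with halve n
... | even m = odd m
... | odd m  = even (suc m)

double≤suc⇒≤ : ∀ {m n} → double m ≤ suc n → m ≤ n
double≤suc⇒≤ {zero}  _         = z≤n
double≤suc⇒≤ {suc m} (s≤s m<n) = ≤-trans (s≤s (n≤double m)) m<n

-- Counting

module _ {A : Set} where

  count : {P : Pred A 0ℓ} → Decidable P → List A → ℕ
  count P? xs = length (filter P? xs)

  count-++ : {P : Pred A 0ℓ} (P? : Decidable P) → ∀ xs ys →
             count P? (xs ++ ys) ≡ count P? xs + count P? ys
  count-++ P? xs ys = trans (cong length (filter-++ P? xs ys)) (length-++ (filter P? xs))

  count-cong : {P Q : Pred A 0ℓ} (P? : Decidable P) (Q? : Decidable Q) → P ≐ Q →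
               ∀ xs → count P? xs ≡ count Q? xs
  count-cong P? Q? P≐Q xs = cong length (filter-≐ P? Q? P≐Q xs)

  count-none : {P : Pred A 0ℓ} (P? : Decidable P) → (∀ x → ¬ P x) → ∀ xs → count P? xs ≡ 0
  count-none P? ¬P xs = cong length (filter-none P? (All.universal ¬P xs))

  count-¬ : {P : Pred A 0ℓ} (P? : Decidable P) → ∀ xs →
            count (¬? ∘ P?) xs + count P? xs ≡ length xs
  count-¬ P? []       = refl
  count-¬ P? (x ∷ xs) with P? x
  ... | yes _ = trans (+-suc _ _) (cong suc (count-¬ P? xs))
  ... | no  _ = cong suc (count-¬ P? xs)

count-map : {A B : Set} {P : Pred B 0ℓ} (P? : Decidable P) (g : A → B) → ∀ xs →
            count P? (map g xs) ≡ count (P? ∘ g) xs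
count-map P? g []       = refl
count-map P? g (x ∷ xs) with P? (g x)
... | yes _ = cong suc (count-map P? g xs)
... | no  _ = count-map P? g xs

-- Finite sums

Σ-+ : ∀ g m n → Σ[ g < m + n ] ≡ Σ[ g < m ] + Σ[ (λ i → g (m + i)) < n ]
Σ-+ g zero    n = refl
Σ-+ g (suc m) n = trans (cong (g 0 +_) (Σ-+ (g ∘ suc) m n)) (sym (+-assoc (g 0) _ _))

Σ-* : ∀ g m n → Σ[ g < m * n ] ≡ Σ[ (λ k → Σ[ (λ j → g (k * n + j)) < n ]) < m ]
Σ-* g zero    n = refl
Σ-* g (suc m) n = trans (Σ-+ g n (m * n))
  (cong (Σ[ g < n ] +_)
    (trans (Σ-* (λ i → g (n + i)) m n)
      (Σ-cong (λ k → Σ-cong (λ j → cong g (sym (+-assoc n (k * n) j))) n) m)))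

Σ-double : ∀ g n → Σ[ g < double n ] ≡ Σ[ (λ i → g (double i) + g (suc (double i))) < n ]
Σ-double g zero    = refl
Σ-double g (suc n) = trans
  (cong (λ t → g 0 + (g 1 + t)) (Σ-double (g ∘ suc ∘ suc) n))
  (sym (+-assoc (g 0) (g 1) _))

Σ-distrib-+ : ∀ g h n → Σ[ (λ i → g i + h i) < n ] ≡ Σ[ g < n ] + Σ[ h < n ]
Σ-distrib-+ g h zero    = refl
Σ-distrib-+ g h (suc n) = trans (cong (g 0 + h 0 +_) (Σ-distrib-+ (g ∘ suc) (h ∘ suc) n))
  (interchange +-commutativeSemigroup (g 0) (h 0) _ _)

Σ-distribˡ-* : ∀ c g n → Σ[ (λ i → c * g i) < n ] ≡ c * Σ[ g < n ]
Σ-distribˡ-* c g zero    = sym (*-zeroʳ c)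
Σ-distribˡ-* c g (suc n) = trans (cong (c * g 0 +_) (Σ-distribˡ-* c (g ∘ suc) n))
  (sym (*-distribˡ-+ c (g 0) _))

Σ-cong-< : ∀ {g h} n → (∀ i → i < n → g i ≡ h i) → Σ[ g < n ] ≡ Σ[ h < n ]
Σ-cong-< zero    g≡h = refl
Σ-cong-< (suc n) g≡h =
  cong₂ _+_ (g≡h 0 (s≤s z≤n)) (Σ-cong-< n (λ i i<n → g≡h (suc i) (s≤s i<n)))

Σ-zero : ∀ n → Σ[ (λ _ → 0) < n ] ≡ 0
Σ-zero zero    = refl
Σ-zero (suc n) = Σ-zero n

Σ-last : ∀ g n → Σ[ g < suc n ] ≡ Σ[ g < n ] + g n
Σ-last g zero    = +-comm (g 0) 0
Σ-last g (suc n) = trans (cong (g 0 +_) (Σ-last (g ∘ suc) n)) (sym (+-assoc (g 0) _ _))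

-- Sliding the window by one step drops `g m` and gains `g (m + N)`, which equals it. `slide` keeps
-- `g m` on both sides to avoid subtraction.
Σ-window : ∀ g N → (∀ n → g (n + N) ≡ g n) → ∀ m → Σ[ (λ i → g (m + i)) < N ] ≡ Σ[ g < N ]
Σ-window g N per zero    = refl
Σ-window g N per (suc m) = trans (+-cancelˡ-≡ (g m) _ _ slide) (Σ-window g N per m)
  where
  w : ℕ → ℕ
  w i = g (m + i)
  slide : g m + Σ[ (λ i → g (suc m + i)) < N ] ≡ g m + Σ[ w < N ]
  slide = begin
    g m + Σ[ (λ i → g (suc m + i)) < N ]
      ≡⟨ cong₂ _+_ (cong g (sym (+-identityʳ m))) (Σ-cong (λ i → cong g (sym (+-suc m i))) N) ⟩
    Σ[ w < suc N ]    ≡⟨ Σ-last w N ⟩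
    Σ[ w < N ] + w N  ≡⟨ cong (Σ[ w < N ] +_) (per m) ⟩
    Σ[ w < N ] + g m  ≡⟨ +-comm _ (g m) ⟩
    g m + Σ[ w < N ]  ∎

-- Parities

-- Lets the number of terms of a given parity be written as a finite sum.
weight : Parity → ℕ
weight 0ℙ = 0
weight 1ℙ = 1

weight-injective : ∀ {x y} → weight x ≡ weight y → x ≡ y
weight-injective {0ℙ} {0ℙ} _ = refl
weight-injective {1ℙ} {1ℙ} _ = refl

n%2≡weight : ∀ n → n % 2 ≡ weight (parity n)
n%2≡weight 0             = refl
n%2≡weight 1             = refl
n%2≡weight (suc (suc n)) = n%2≡weight n

count-applyUpTo : {P : Pred ℕ 0ℓ} (P? : Decidable P) (w : ℕ → ℕ) →
                  (∀ {t} → P t → w t ≡ 1) → (∀ {t} → ¬ P t → w t ≡ 0) →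
                  ∀ g n → count P? (applyUpTo g n) ≡ Σ[ w ∘ g < n ]
count-applyUpTo P? w w≡1 w≡0 g zero    = refl
count-applyUpTo P? w w≡1 w≡0 g (suc n) with P? (g 0)
... | yes p = cong₂ _+_ (sym (w≡1 p)) (count-applyUpTo P? w w≡1 w≡0 (g ∘ suc) n)
... | no ¬p = cong₂ _+_ (sym (w≡0 ¬p)) (count-applyUpTo P? w w≡1 w≡0 (g ∘ suc) n)

count-2∣ : ∀ g n → count (2 ∣?_) (applyUpTo g n) ≡ Σ[ (λ i → weight (parity (g i) ⁻¹)) < n ]
count-2∣ = count-applyUpTo (2 ∣?_) (λ t → weight (parity t ⁻¹)) even⇒1 odd⇒0
  where
  even⇒1 : ∀ {t} → 2 ∣ t → weight (parity t ⁻¹) ≡ 1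
  even⇒1 {t} 2∣t = cong (weight ∘ _⁻¹)
    (weight-injective {y = 0ℙ} (trans (sym (n%2≡weight t)) (n∣m⇒m%n≡0 t 2 2∣t)))

  odd⇒0 : ∀ {t} → ¬ 2 ∣ t → weight (parity t ⁻¹) ≡ 0
  odd⇒0 {t} 2∤t with parity t | n%2≡weight t
  ... | 0ℙ | eq = contradiction (m%n≡0⇒n∣m t 2 eq) 2∤t
  ... | 1ℙ | _  = refl

-- Pascal's triangle modulo 2

pascal : ℕ → ℕ → Parity
pascal n k = parity (n C k)

pascal-suc : ∀ n k → pascal (suc n) (suc k) ≡ pascal n k ℙ.+ pascal n (suc k)
pascal-suc n k = trans (cong parity (sym (nCk+nC[k+1]≡[n+1]C[k+1] n k))) (ℙ.+-homo-+ (n C k) _)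

n<k⇒pascal≡0 : ∀ {n k} → n < k → pascal n k ≡ 0ℙ
n<k⇒pascal≡0 = cong parity ∘ k>n⇒nCk≡0

pascal-diagonal : ∀ n → pascal n n ≡ 1ℙ
pascal-diagonal = cong parity ∘ nCn≡1

-- Lucas's theorem at the prime 2, for the last binary digits of `n` and `k`. In the mutual
-- recursion Pascal's rule derives each odd row from the even row above it, and each even row from
-- the odd row above it.
pascal-even-even : ∀ n k → pascal (double n) (double k) ≡ pascal n k
pascal-even-odd  : ∀ n k → pascal (double n) (suc (double k)) ≡ 0ℙ
pascal-odd-even  : ∀ n k → pascal (suc (double n)) (double k) ≡ pascal n k
pascal-odd-odd   : ∀ n k → pascal (suc (double n)) (suc (double k)) ≡ pascal n k

pascal-even-even zero    zero    = refl
pascal-even-even zero    (suc k) = refl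
pascal-even-even (suc n) zero    = refl
pascal-even-even (suc n) (suc k) = begin
  pascal (double (suc n)) (double (suc k))
    ≡⟨ pascal-suc (suc (double n)) (suc (double k)) ⟩
  pascal (suc (double n)) (suc (double k)) ℙ.+ pascal (suc (double n)) (double (suc k))
    ≡⟨ cong₂ ℙ._+_ (pascal-odd-odd n k) (pascal-odd-even n (suc k)) ⟩
  pascal n k ℙ.+ pascal n (suc k)
    ≡⟨ pascal-suc n k ⟨
  pascal (suc n) (suc k) ∎

pascal-even-odd zero    k = refl
pascal-even-odd (suc n) k = begin
  pascal (double (suc n)) (suc (double k))
    ≡⟨ pascal-suc (suc (double n)) (double k) ⟩
  pascal (suc (double n)) (double k) ℙ.+ pascal (suc (double n)) (suc (double k))
    ≡⟨ cong₂ ℙ._+_ (pascal-odd-even n k) (pascal-odd-odd n k) ⟩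
  pascal n k ℙ.+ pascal n k
    ≡⟨ ℙ.p+p≡0ℙ (pascal n k) ⟩
  0ℙ ∎

pascal-odd-even n zero    = refl
pascal-odd-even n (suc k) = trans (pascal-suc (double n) (suc (double k)))
  (cong₂ ℙ._+_ (pascal-even-odd n k) (pascal-even-even n (suc k)))

pascal-odd-odd n k = trans (pascal-suc (double n) (double k))
  (trans (cong₂ ℙ._+_ (pascal-even-even n k) (pascal-even-odd n k)) (ℙ.+-identityʳ _))

-- Modulo 2 this is (1 + x)^(2^r) = 1 + x^(2^r). By induction on `r`: odd columns of an even row
-- vanish, and even columns pass to half the row and half the column.
pascal-2^r : ∀ r j → 0 < j → j < 2 ^ r → pascal (2 ^ r) j ≡ 0ℙ
pascal-2^r zero    (suc j) _ (s≤s ())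
pascal-2^r (suc r) j 0<j j<2^r =
  subst (λ n → pascal n j ≡ 0ℙ) (double≡2*n (2 ^ r))
    (step (halve j) 0<j (subst (j <_) (sym (double≡2*n (2 ^ r))) j<2^r))
  where
  step : ∀ {j} → Halved j → 0 < j → j < double (2 ^ r) → pascal (double (2 ^ r)) j ≡ 0ℙ
  step (odd i)        _ _ = pascal-even-odd (2 ^ r) i
  step (even (suc i)) _ j< = trans (pascal-even-even (2 ^ r) (suc i))
    (pascal-2^r r (suc i) (s≤s z≤n) (≰⇒> (λ 2^r≤ → <⇒≱ j< (double-mono 2^r≤))))

-- Entries right of the diagonal are zero, so the square holds exactly the odd entries of the first
-- `n` rows of the triangle.
odds : ℕ → ℕ
odds n = Σ[ (λ k → Σ[ (λ j → weight (pascal k j)) < n ]) < n ]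

-- Self-similarity of the Sierpinski triangle: each entry becomes a 2 by 2 block with three copies
-- of itself and one zero, one copy in the even row and two in the odd row.
odds-double : ∀ n → odds (double n) ≡ 3 * odds n
odds-double n = begin
  odds (double n)
    ≡⟨ Σ-double (row (double n)) n ⟩
  Σ[ (λ k → row (double n) (double k) + row (double n) (suc (double k))) < n ]
    ≡⟨ Σ-cong (λ k → cong₂ _+_ (even-row k) (odd-row k)) n ⟩
  Σ[ (λ k → row n k + (row n k + row n k)) < n ]
    ≡⟨ Σ-cong (λ k → cong (λ t → row n k + (row n k + t)) (sym (+-identityʳ (row n k)))) n ⟩
  Σ[ (λ k → 3 * row n k) < n ]
    ≡⟨ Σ-distribˡ-* 3 (row n) n ⟩
  3 * odds n ∎
  where
  row : ℕ → ℕ → ℕ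
  row n k = Σ[ (λ j → weight (pascal k j)) < n ]

  even-row : ∀ k → row (double n) (double k) ≡ row n k
  even-row k = trans (Σ-double (weight ∘ pascal (double k)) n)
    (Σ-cong (λ j → trans
      (cong₂ (λ x y → weight x + weight y) (pascal-even-even k j) (pascal-even-odd k j))
      (+-identityʳ _)) n)

  odd-row : ∀ k → row (double n) (suc (double k)) ≡ row n k + row n k
  odd-row k = trans (Σ-double (weight ∘ pascal (suc (double k))) n)
    (trans
      (Σ-cong (λ j →
        cong₂ (λ x y → weight x + weight y) (pascal-odd-even k j) (pascal-odd-odd k j)) n)
      (Σ-distrib-+ (weight ∘ pascal k) (weight ∘ pascal k) n))

odds-2^r : ∀ r → odds (2 ^ r) ≡ 3 ^ r
odds-2^r zero    = refl
odds-2^r (suc r) = begin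
  odds (2 * 2 ^ r)       ≡⟨ cong odds (sym (double≡2*n (2 ^ r))) ⟩
  odds (double (2 ^ r))  ≡⟨ odds-double (2 ^ r) ⟩
  3 * odds (2 ^ r)       ≡⟨ cong (3 *_) (odds-2^r r) ⟩
  3 * 3 ^ r              ∎

-- Counting representations

-- Stands for s(n - d), with default `z` when n < d. On generating functions, with `z` zero, it is
-- multiplication by x^d.
delay : {A : Set} → A → ℕ → (ℕ → A) → ℕ → A
delay z zero    s n       = s n
delay z (suc d) s zero    = z
delay z (suc d) s (suc n) = delay z d s n

delay-map : {A B : Set} (h : A → B) (z : A) → ∀ d s n →
            h (delay z d s n) ≡ delay (h z) d (h ∘ s) n
delay-map h z zero    s n       = refl
delay-map h z (suc d) s zero    = refl
delay-map h z (suc d) s (suc n) = delay-map h z d s n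

module _ {A : Set} {z : A} where

  delay-cong : ∀ d {s t} n → (∀ i → i ≤ n → s i ≡ t i) → delay z d s n ≡ delay z d t n
  delay-cong zero    n       s≡t = s≡t n ≤-refl
  delay-cong (suc d) zero    s≡t = refl
  delay-cong (suc d) (suc n) s≡t = delay-cong d n (λ i i≤n → s≡t i (m≤n⇒m≤1+n i≤n))

  delay-delay : ∀ d e s n → delay z d (delay z e s) n ≡ delay z (d + e) s n
  delay-delay zero    e s n       = refl
  delay-delay (suc d) e s zero    = refl
  delay-delay (suc d) e s (suc n) = delay-delay d e s n

  delay-zip : (_∙_ : A → A → A) → z ∙ z ≡ z → ∀ d s t n →
              delay z d (λ i → s i ∙ t i) n ≡ delay z d s n ∙ delay z d t n
  delay-zip _∙_ zz zero    s t n       = refl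
  delay-zip _∙_ zz (suc d) s t zero    = sym zz
  delay-zip _∙_ zz (suc d) s t (suc n) = delay-zip _∙_ zz d s t n

  delay-< : ∀ d s {n} → n < d → delay z d s n ≡ z
  delay-< (suc d) s {zero}  _         = refl
  delay-< (suc d) s {suc n} (s≤s n<d) = delay-< d s n<d

  delay-+ : ∀ d s n → delay z d s (d + n) ≡ s n
  delay-+ zero    s n = refl
  delay-+ (suc d) s n = delay-+ d s n

  delay-even-even : ∀ d s n → delay z (double d) s (double n) ≡ delay z d (s ∘ double) n
  delay-even-even zero    s n       = refl
  delay-even-even (suc d) s zero    = refl
  delay-even-even (suc d) s (suc n) = delay-even-even d s n

  delay-even-odd : ∀ d s n →
                   delay z (double d) s (suc (double n)) ≡ delay z d (s ∘ suc ∘ double) n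
  delay-even-odd zero    s n       = refl
  delay-even-odd (suc d) s zero    = delay-< (suc (double d)) s {zero} (s≤s z≤n)
  delay-even-odd (suc d) s (suc n) = delay-even-odd d s n

  -- For n > d the index 2n - (2d + 1) is 2(n - d - 1) + 1: an odd index, at the cost of one more
  -- step of delay.
  delay-odd-even : ∀ d s n →
                   delay z (suc (double d)) s (double n) ≡ delay z (suc d) (s ∘ suc ∘ double) n
  delay-odd-even d s zero    = refl
  delay-odd-even d s (suc n) = delay-even-odd d s n

val : ∀ {k} → Vec ℕ k → ℕ
val {k} v = Σ[ (λ i → at v i * 2 ^ i) < k ]

val-∷ : ∀ {k} a (v : Vec ℕ k) → val (a ∷ v) ≡ a + double (val v)
val-∷ {k} a v = cong₂ _+_ (*-identityʳ a) (begin
  Σ[ (λ i → at v i * (2 * 2 ^ i)) < k ]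
    ≡⟨ Σ-cong (λ i → shuffle (at v i) (2 ^ i)) k ⟩
  Σ[ (λ i → 2 * (at v i * 2 ^ i)) < k ]
    ≡⟨ Σ-distribˡ-* 2 (λ i → at v i * 2 ^ i) k ⟩
  2 * val v
    ≡⟨ double≡2*n (val v) ⟨
  double (val v) ∎)
  where
  shuffle : ∀ a b → a * (2 * b) ≡ 2 * (a * b)
  shuffle = solve-∀

-- Word length `k` and target `n` are kept apart, because removing the lowest digit shortens the
-- word by one but roughly halves the target.
reps : List ℕ → ℕ → ℕ → ℕ
reps xs k n = count (λ w → val w ≟ n) (words xs k)

module _ (xs : List ℕ) (k : ℕ) where

  -- By `val-∷`, these are the words with lowest digit `d` and value `n`, counted through their
  -- tails.
  shiftedReps : ℕ → ℕ → ℕ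
  shiftedReps d n = count (λ w → d + double (val w) ≟ n) (words xs k)

  reps-offset : ∀ d n → count (λ w → d + val w ≟ n) (words xs k) ≡ delay 0 d (reps xs k) n
  reps-offset zero    n       = refl
  reps-offset (suc d) zero    =
    count-none (λ w → suc d + val w ≟ zero) (λ w ()) (words xs k)
  reps-offset (suc d) (suc n) = trans
    (count-cong (λ w → suc d + val w ≟ suc n) (λ w → d + val w ≟ n)
      (suc-injective , cong suc) (words xs k))
    (reps-offset d n)

  shiftedReps-even-even : ∀ d n → shiftedReps (double d) (double n) ≡ delay 0 d (reps xs k) n
  shiftedReps-even-even d n = trans
    (count-cong (λ w → double d + double (val w) ≟ double n) (λ w → d + val w ≟ n)
      ( (λ {w} eq → double-injective (trans (sym (double-+ d (val w))) eq))
      , (λ {w} eq → trans (double-+ d (val w)) (cong double eq)))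
      (words xs k))
    (reps-offset d n)

  shiftedReps-odd-odd : ∀ n → shiftedReps 1 (suc (double n)) ≡ reps xs k n
  shiftedReps-odd-odd n =
    count-cong (λ w → suc (double (val w)) ≟ suc (double n)) (λ w → val w ≟ n)
      (double-injective ∘ suc-injective , cong (suc ∘ double)) (words xs k)

  shiftedReps-odd-even : ∀ n → shiftedReps 1 (double n) ≡ 0
  shiftedReps-odd-even n = count-none (λ w → suc (double (val w)) ≟ double n)
    (λ w eq → double≢suc-double n (val w) (sym eq)) (words xs k)

  shiftedReps-even-odd : ∀ d n → shiftedReps (double d) (suc (double n)) ≡ 0
  shiftedReps-even-odd d n = count-none (λ w → double d + double (val w) ≟ suc (double n))
    (λ w eq → double≢suc-double (d + val w) n (trans (sym (double-+ d (val w))) eq))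
    (words xs k)

  reps-suc : ∀ n → reps xs (suc k) n ≡ sum (map (λ a → shiftedReps a n) xs)
  reps-suc n = go xs
    where
    -- Only the choices of the lowest digit are recursed on; the tails go on using all of `xs`.
    go : ∀ as → count (λ w → val w ≟ n) (cartesianProductWith _∷_ as (words xs k))
                ≡ sum (map (λ a → shiftedReps a n) as)
    go []       = refl
    go (a ∷ as) = trans
      (count-++ (λ w → val w ≟ n) (map (a ∷_) (words xs k)) _)
      (cong₂ _+_
        (trans (count-map (λ w → val w ≟ n) (a ∷_) (words xs k))
          (count-cong (λ w → val (a ∷ w) ≟ n) (λ w → a + double (val w) ≟ n)
            ( (λ {w} eq → trans (sym (val-∷ a w)) eq)
            , (λ {w} eq → trans (val-∷ a w) eq))
            (words xs k)))
        (go as))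

-- The digits of 𝒜 r with 2 ^ r = double p.
digits : ℕ → List ℕ
digits p = 0 ∷ 1 ∷ double p ∷ double (suc p) ∷ []

module _ (p : ℕ) where

  private
    R : ℕ → ℕ → ℕ
    R = reps (digits p)

  -- An even target needs an even lowest digit: 0, 2p or 2p + 2. Subtracting it and halving leaves
  -- n, n - p or n - p - 1.
  reps-even : ∀ k n → R (suc k) (double n) ≡ R k n + (delay 0 p (R k) n + delay 0 (suc p) (R k) n)
  reps-even k n = begin
    R (suc k) (double n)
      ≡⟨ reps-suc (digits p) k (double n) ⟩
    S 0 + (S 1 + (S (double p) + (S (double (suc p)) + 0)))
      ≡⟨ cong₂ _+_ (shiftedReps-even-even (digits p) k 0 n)
           (cong₂ _+_ (shiftedReps-odd-even (digits p) k n)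
             (cong₂ _+_ (shiftedReps-even-even (digits p) k p n)
               (trans (+-identityʳ _) (shiftedReps-even-even (digits p) k (suc p) n)))) ⟩
    R k n + (delay 0 p (R k) n + delay 0 (suc p) (R k) n) ∎
    where
    S : ℕ → ℕ
    S a = shiftedReps (digits p) k a (double n)

  -- Only the digit 1 is odd.
  reps-odd : ∀ k n → R (suc k) (suc (double n)) ≡ R k n
  reps-odd k n = begin
    R (suc k) (suc (double n))
      ≡⟨ reps-suc (digits p) k (suc (double n)) ⟩
    S 0 + (S 1 + (S (double p) + (S (double (suc p)) + 0)))
      ≡⟨ cong₂ _+_ (shiftedReps-even-odd (digits p) k 0 n)
           (cong₂ _+_ (shiftedReps-odd-odd (digits p) k n)
             (cong₂ _+_ (shiftedReps-even-odd (digits p) k p n)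
               (trans (+-identityʳ _) (shiftedReps-even-odd (digits p) k (suc p) n)))) ⟩
    R k n + 0
      ≡⟨ +-identityʳ _ ⟩
    R k n ∎
    where
    S : ℕ → ℕ
    S a = shiftedReps (digits p) k a (suc (double n))

  even-cong : ∀ {g h} n → (∀ i → i ≤ n → g i ≡ h i) →
              g n + (delay 0 p g n + delay 0 (suc p) g n)
              ≡ h n + (delay 0 p h n + delay 0 (suc p) h n)
  even-cong n g≡h = cong₂ _+_ (g≡h n ≤-refl)
    (cong₂ _+_ (delay-cong p n g≡h) (delay-cong (suc p) n g≡h))

  module _ (0<p : 0 < p) where

    -- A word as long as its target already has room for every nonzero digit. Induction on the
    -- length: dropping the lowest digit shortens both words by one, and the halved target stays
    -- within the bound.
    reps-suc-stable : ∀ k n → n ≤ k → R (suc k) n ≡ R k n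
    -- At target 0 both delayed terms take their default value, because the delays `p` and `suc p`
    -- are positive.
    reps-suc-stable zero    zero    _   = trans (reps-even 0 0)
      (cong (R 0 0 +_) (cong₂ _+_ (delay-< p (R 0) 0<p) (delay-< (suc p) (R 0) (s≤s z≤n))))
    reps-suc-stable (suc k) n n≤ with halve n
    ... | even m = begin
      R (2 + k) (double m)
        ≡⟨ reps-even (suc k) m ⟩
      R (suc k) m + (delay 0 p (R (suc k)) m + delay 0 (suc p) (R (suc k)) m)
        ≡⟨ even-cong m (λ i i≤m →
             reps-suc-stable k i (≤-trans i≤m (double≤suc⇒≤ n≤))) ⟩
      R k m + (delay 0 p (R k) m + delay 0 (suc p) (R k) m)
        ≡⟨ reps-even k m ⟨
      R (suc k) (double m) ∎
    ... | odd m  = begin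
      R (2 + k) (suc (double m))  ≡⟨ reps-odd (suc k) m ⟩
      R (suc k) m
        ≡⟨ reps-suc-stable k m (double≤suc⇒≤ (≤-trans (n≤1+n _) n≤)) ⟩
      R k m                       ≡⟨ reps-odd k m ⟨
      R (suc k) (suc (double m))  ∎

    reps-stable : ∀ d n → R (d + n) n ≡ R n n
    reps-stable zero    n = refl
    reps-stable (suc d) n = trans (reps-suc-stable (d + n) n (m≤n+m n d)) (reps-stable d n)

    repCount : ℕ → ℕ
    repCount n = R n n

    R≡repCount : ∀ k n → n ≤ k → R k n ≡ repCount n
    R≡repCount k n n≤k = subst (λ k → R k n ≡ R n n) (m∸n+n≡m n≤k) (reps-stable (k ∸ n) n)

    repCount-even : ∀ n → repCount (double n) ≡
                    repCount n + (delay 0 p repCount n + delay 0 (suc p) repCount n)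
    repCount-even n = begin
      R (double n) (double n)
        -- One extra digit leaves the count unchanged and exposes a lowest digit for `reps-even`,
        -- even when n = 0.
        ≡⟨ reps-suc-stable (double n) (double n) ≤-refl ⟨
      R (suc (double n)) (double n)
        ≡⟨ reps-even (double n) n ⟩
      R (double n) n + (delay 0 p (R (double n)) n + delay 0 (suc p) (R (double n)) n)
        ≡⟨ even-cong n (λ i i≤n → R≡repCount (double n) i (≤-trans i≤n (n≤double n))) ⟩
      repCount n + (delay 0 p repCount n + delay 0 (suc p) repCount n) ∎

    repCount-odd : ∀ n → repCount (suc (double n)) ≡ repCount n
    repCount-odd n = trans (reps-odd (double n) n) (R≡repCount (double n) n (n≤double n))

-- The trinomial recurrence modulo 2.

-- The recursion makes the left side of trinomial take the same value at 2n and at 2n + 1 as at n.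
module SelfSimilar
  (p : ℕ) (s : ℕ → Parity) (0<p : 0 < p) (s-zero : s 0 ≡ 1ℙ)
  (s-even : ∀ n → s (double n) ≡ s n ℙ.+ (delay 0ℙ p s n ℙ.+ delay 0ℙ (suc p) s n))
  (s-odd : ∀ n → s (suc (double n)) ≡ s n)
  where

  q : ℕ
  q = double p

  private
    D : ℕ → ℕ → Parity
    D d n = delay 0ℙ d s n

    H : ℕ → Parity
    H n = s n ℙ.+ (D q n ℙ.+ D (suc q) n)

    -- s(2n - q) is s(2(n - p)), so `s-even` applies under the delay `p`; the delays add up to p, p
    -- + p = q and p + (p + 1) = q + 1.
    D-q-even : ∀ n → D q (double n) ≡ D p n ℙ.+ (D q n ℙ.+ D (suc q) n)
    D-q-even n = begin
      D q (double n)
        ≡⟨ delay-even-even p s n ⟩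
      delay 0ℙ p (s ∘ double) n
        ≡⟨ delay-cong p n (λ i _ → s-even i) ⟩
      delay 0ℙ p (λ i → s i ℙ.+ (D p i ℙ.+ D (suc p) i)) n
        ≡⟨ delay-zip ℙ._+_ refl p s (λ i → D p i ℙ.+ D (suc p) i) n ⟩
      D p n ℙ.+ delay 0ℙ p (λ i → D p i ℙ.+ D (suc p) i) n
        ≡⟨ cong (D p n ℙ.+_) (delay-zip ℙ._+_ refl p (D p) (D (suc p)) n) ⟩
      D p n ℙ.+ (delay 0ℙ p (D p) n ℙ.+ delay 0ℙ p (D (suc p)) n)
        ≡⟨ cong (D p n ℙ.+_) (cong₂ ℙ._+_
             (trans (delay-delay p p s n) (cong (λ d → D d n) (sym (double≡n+n p))))
             (trans (delay-delay p (suc p) s n)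
               (cong (λ d → D d n) (trans (+-suc p p) (cong suc (sym (double≡n+n p))))))) ⟩
      D p n ℙ.+ (D q n ℙ.+ D (suc q) n) ∎

    D-q-odd : ∀ n → D q (suc (double n)) ≡ D p n
    D-q-odd n = trans (delay-even-odd p s n) (delay-cong p n (λ i _ → s-odd i))

    D-suc-q-even : ∀ n → D (suc q) (double n) ≡ D (suc p) n
    D-suc-q-even n = trans (delay-odd-even p s n) (delay-cong (suc p) n (λ i _ → s-odd i))

    -- In characteristic 2 the terms `b` and `c`, which will be those delayed by `p` and `suc p`,
    -- occur twice and cancel.
    cancel-even : ∀ a b c x → (a ℙ.+ (b ℙ.+ c)) ℙ.+ ((b ℙ.+ x) ℙ.+ c) ≡ a ℙ.+ x
    cancel-even 0ℙ 0ℙ 0ℙ x = ℙ.+-identityʳ x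
    cancel-even 0ℙ 0ℙ 1ℙ 0ℙ = refl
    cancel-even 0ℙ 0ℙ 1ℙ 1ℙ = refl
    cancel-even 0ℙ 1ℙ 0ℙ 0ℙ = refl
    cancel-even 0ℙ 1ℙ 0ℙ 1ℙ = refl
    cancel-even 0ℙ 1ℙ 1ℙ 0ℙ = refl
    cancel-even 0ℙ 1ℙ 1ℙ 1ℙ = refl
    cancel-even 1ℙ 0ℙ 0ℙ 0ℙ = refl
    cancel-even 1ℙ 0ℙ 0ℙ 1ℙ = refl
    cancel-even 1ℙ 0ℙ 1ℙ 0ℙ = refl
    cancel-even 1ℙ 0ℙ 1ℙ 1ℙ = refl
    cancel-even 1ℙ 1ℙ 0ℙ 0ℙ = refl
    cancel-even 1ℙ 1ℙ 0ℙ 1ℙ = refl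
    cancel-even 1ℙ 1ℙ 1ℙ 0ℙ = refl
    cancel-even 1ℙ 1ℙ 1ℙ 1ℙ = refl

    cancel-odd : ∀ b x → b ℙ.+ (b ℙ.+ x) ≡ x
    cancel-odd b x = trans (sym (ℙ.+-assoc b b x)) (cong (ℙ._+ x) (ℙ.p+p≡0ℙ b))

    H-even : ∀ n → H (double n) ≡ H n
    H-even n = trans
      (cong₂ ℙ._+_ (s-even n) (cong₂ ℙ._+_ (D-q-even n) (D-suc-q-even n)))
      (cancel-even (s n) (D p n) (D (suc p) n) (D q n ℙ.+ D (suc q) n))

    H-odd : ∀ n → H (suc (double n)) ≡ H n
    H-odd n = trans
      (cong₂ ℙ._+_ (s-odd n) (cong₂ ℙ._+_ (D-q-odd n) (D-q-even n)))
      (cong (s n ℙ.+_) (cancel-odd (D p n) _))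

    q>0 : 0 < q
    q>0 = ≤-trans 0<p (n≤double p)

  trinomial : ∀ n → s n ℙ.+ (D q n ℙ.+ D (suc q) n) ≡ 1ℙ
  trinomial = <-rec (λ n → H n ≡ 1ℙ) step
    where
    step : ∀ n → (∀ {m} → m < n → H m ≡ 1ℙ) → H n ≡ 1ℙ
    step n rec with halve n
    -- `H-even` would send 0 back to 0, so this base case is evaluated directly.
    ... | even zero    = cong₂ ℙ._+_ s-zero
      (cong₂ ℙ._+_ (delay-< q s q>0) (delay-< (suc q) s (s≤s z≤n)))
    ... | even (suc m) = trans (H-even (suc m)) (rec (s≤s (s≤s (n≤double m))))
    ... | odd m        = trans (H-odd m) (rec (s≤s (n≤double m)))

  low : ∀ n → n < q → s n ≡ 1ℙ
  low n n<q = begin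
    s n              ≡⟨ ℙ.+-identityʳ (s n) ⟨
    s n ℙ.+ 0ℙ       ≡⟨ cong (s n ℙ.+_)
                          (cong₂ ℙ._+_ (delay-< q s n<q) (delay-< (suc q) s (m<n⇒m<1+n n<q))) ⟨
    H n              ≡⟨ trinomial n ⟩
    1ℙ               ∎

  -- The term delayed by `q` reads `s 0`, which is 1, while the one delayed by `suc q` is still 0.
  at-q : s q ≡ 0ℙ
  at-q = ℙ.+-cancelʳ-≡ 1ℙ (s q) 0ℙ (begin
    s q ℙ.+ 1ℙ       ≡⟨ cong (s q ℙ.+_) (cong₂ ℙ._+_
                          (trans (trans (cong (D q) (sym (+-identityʳ q))) (delay-+ q s 0)) s-zero)
                          (delay-< (suc q) s (n<1+n q))) ⟨
    H q              ≡⟨ trinomial q ⟩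
    1ℙ               ∎)

  step : ∀ i → s (q + suc i) ℙ.+ (s (suc i) ℙ.+ s i) ≡ 1ℙ
  step i = trans
    (cong (s (q + suc i) ℙ.+_) (cong₂ ℙ._+_
      (sym (delay-+ q s (suc i)))
      (sym (trans (cong (D (suc q)) (+-suc q i)) (delay-+ (suc q) s i)))))
    (trinomial (q + suc i))

-- The homogeneous recurrence and its period.

-- Satisfied by the complement of the sequence s of SelfSimilar.
module Trinomial
  (q′ : ℕ) (b : ℕ → Parity) (1<q : 1 < suc q′)
  (b-low : ∀ n → n < suc q′ → b n ≡ 0ℙ) (b-q : b (suc q′) ≡ 1ℙ)
  (b-step : ∀ i → b (suc q′ + suc i) ≡ b (suc i) ℙ.+ b i)
  (pascal-q : ∀ j → 0 < j → j < suc q′ → pascal (suc q′) j ≡ 0ℙ)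
  where

  private
    q : ℕ
    q = suc q′

  -- `b-step` adds the entry one row above and its left neighbour, as in Pascal's rule. In column 0
  -- that neighbour wraps round to the end of an earlier row, where `row-end` makes it zero; this
  -- needs the bound on `k`.
  rows : ∀ k j → k ≤ q → j < q → b (suc k * q + j) ≡ pascal k j
  rows zero    zero    _ _ = trans (cong b (trans (+-identityʳ _) (+-identityʳ q))) b-q
  rows zero    (suc j) _ j<q = begin
    b (q + 0 + suc j)      ≡⟨ cong (λ n → b (n + suc j)) (+-identityʳ q) ⟩
    b (q + suc j)          ≡⟨ b-step j ⟩
    b (suc j) ℙ.+ b j      ≡⟨ cong₂ ℙ._+_ (b-low (suc j) j<q) (b-low j (<-trans (n<1+n j) j<q)) ⟩
    0ℙ                     ∎
  rows (suc k) (suc j) k<q j<q = begin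
    b (q + suc k * q + suc j)
      ≡⟨ cong b (trans (+-assoc q (suc k * q) (suc j)) (cong (q +_) (+-suc (suc k * q) j))) ⟩
    b (q + suc (suc k * q + j))
      ≡⟨ b-step (suc k * q + j) ⟩
    b (suc (suc k * q + j)) ℙ.+ b (suc k * q + j)
      ≡⟨ cong₂ ℙ._+_
           (trans (cong b (sym (+-suc (suc k * q) j))) (rows k (suc j) (<⇒≤ k<q) j<q))
           (rows k j (<⇒≤ k<q) (<-trans (n<1+n j) j<q)) ⟩
    pascal k (suc j) ℙ.+ pascal k j
      ≡⟨ ℙ.+-comm (pascal k (suc j)) (pascal k j) ⟩
    pascal k j ℙ.+ pascal k (suc j)
      ≡⟨ pascal-suc k j ⟨
    pascal (suc k) (suc j) ∎
  rows (suc k) zero    k<q _ = begin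
    b (q + suc k * q + 0)
      ≡⟨ cong b (+-identityʳ _) ⟩
    b (q + suc (q′ + k * q))
      ≡⟨ b-step (q′ + k * q) ⟩
    b (suc k * q) ℙ.+ b (q′ + k * q)
      ≡⟨ cong₂ ℙ._+_
           (trans (cong b (sym (+-identityʳ _))) (rows k 0 (<⇒≤ k<q) (s≤s z≤n)))
           (trans (cong b (+-comm q′ (k * q))) (row-end k k<q)) ⟩
    1ℙ ∎
    where
    -- This is the end of row `k - 1` of the triangle, or of the initial zeros. Since k - 1 < q′ it
    -- lies right of the diagonal; row q′ would end in 1 instead, which is how the pattern breaks in
    -- `after-M`.
    row-end : ∀ k → k < q → b (k * q + q′) ≡ 0ℙ
    row-end zero    _         = b-low q′ (n<1+n q′)
    row-end (suc k) (s≤s k<q′) =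
      trans (rows k q′ (<⇒≤ (m<n⇒m<1+n k<q′)) (n<1+n q′)) (n<k⇒pascal≡0 k<q′)

  -- Where row `q` of the triangle begins; the period is `suc M`.
  M : ℕ
  M = suc q * q

  b-M : b M ≡ 1ℙ
  b-M = trans (cong b (sym (+-identityʳ M))) (rows q 0 ≤-refl (s≤s z≤n))

  -- Row `q` is 1 followed by zeros, which settles i < q′. The last two values lie beyond `rows` and
  -- come from `b-step`.
  after-M : ∀ i → i ≤ q → b (M + suc i) ≡ b i
  after-M i i≤q with <-cmp i q′
  ... | tri< i<q′ _ _ = begin
    b (M + suc i)   ≡⟨ rows q (suc i) ≤-refl (s≤s i<q′) ⟩
    pascal q (suc i) ≡⟨ pascal-q (suc i) (s≤s z≤n) (s≤s i<q′) ⟩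
    0ℙ              ≡⟨ b-low i (m<n⇒m<1+n i<q′) ⟨
    b i             ∎
  -- The wrapped neighbour is now the diagonal entry of row q′, so the sum is 1 + 1 = 0.
  ... | tri≈ _ refl _ = begin
    b (M + q)                     ≡⟨ cong b (+-comm M q) ⟩
    b (q + M)                     ≡⟨ b-step (q′ + q * q) ⟩
    b M ℙ.+ b (q′ + q * q)        ≡⟨ cong₂ ℙ._+_ b-M
                                      (trans (cong b (+-comm q′ (q * q)))
                                        (trans (rows q′ q′ (n≤1+n q′) (n<1+n q′)) (pascal-diagonal q′))) ⟩
    0ℙ                            ≡⟨ b-low q′ (n<1+n q′) ⟨
    b q′                          ∎
  -- Column 1 of row `q` is an interior zero because 1 < q, so the sum is 0 + 1.
  ... | tri> _ _ q≤i with refl ← ≤-antisym i≤q q≤i = begin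
    b (M + suc q)          ≡⟨ cong b (trans (+-comm M (suc q)) (sym (+-suc q M))) ⟩
    b (q + suc M)          ≡⟨ b-step M ⟩
    b (suc M) ℙ.+ b M      ≡⟨ cong₂ ℙ._+_
                                (trans (cong b (sym (+-comm M 1)))
                                  (trans (rows q 1 ≤-refl 1<q) (pascal-q 1 (s≤s z≤n) 1<q)))
                                b-M ⟩
    1ℙ                     ≡⟨ b-q ⟨
    b q                    ∎

  -- A recurrence of order q + 1 is determined by q + 1 consecutive values, and `after-M` matches
  -- those at 0, ..., q.
  period : ∀ n → b (n + suc M) ≡ b n
  period n = trans (cong b (trans (+-comm n (suc M)) (sym (+-suc M n)))) (<-rec P step n)
    where
    P : ℕ → Set
    P n = b (M + suc n) ≡ b n

    step : ∀ n → (∀ {m} → m < n → P m) → P n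
    step n rec with n ≤? q
    ... | yes n≤q = after-M n n≤q
    ... | no  n≰q with (i , refl) ← m≤n⇒∃[o]m+o≡n (≰⇒> n≰q) = begin
      b (M + suc (suc q + i))
        ≡⟨ cong b (rearrange M q i) ⟩
      b (q + suc (M + suc i))
        ≡⟨ b-step (M + suc i) ⟩
      b (suc (M + suc i)) ℙ.+ b (M + suc i)
        ≡⟨ cong₂ ℙ._+_
             (trans (cong b (sym (+-suc M (suc i)))) (rec (s≤s (s≤s (m≤n+m i q′)))))
             (rec (s≤s (m≤n+m i q))) ⟩
      b (suc i) ℙ.+ b i
        ≡⟨ b-step i ⟨
      b (q + suc i)
        ≡⟨ cong b (+-suc q i) ⟩
      b (suc q + i) ∎
      where
      rearrange : ∀ M q i → M + suc (suc q + i) ≡ q + suc (M + suc i)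
      rearrange = solve-∀

  no-shorter-period : ∀ t → 0 < t → (∀ n → b (n + t) ≡ b n) → suc M ≤ t
  no-shorter-period (suc t) _ per = ≰⇒> (λ t<M → contradiction (contra t<M) (λ ()))
    where
    u j i : ℕ
    u = t / q
    j = t % q
    -- The distance from `suc t` up to the next multiple of `q`. It is below `q`, so `b i` is one of
    -- the initial zeros.
    i = q′ ∸ j

    i+t≡ : i + suc t ≡ suc u * q + 0
    i+t≡ = begin
      i + suc t               ≡⟨ cong (λ n → i + suc n) (m≡m%n+[m/n]*n t q) ⟩
      i + suc (j + u * q)     ≡⟨ +-suc i (j + u * q) ⟩
      suc (i + (j + u * q))   ≡⟨ cong suc (+-assoc i j (u * q)) ⟨
      suc (i + j + u * q)     ≡⟨ cong (λ n → suc (n + u * q)) (m∸n+n≡m (≤-pred (m%n<n t q))) ⟩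
      suc u * q               ≡⟨ +-identityʳ _ ⟨
      suc u * q + 0           ∎

    contra : suc t ≤ M → 0ℙ ≡ 1ℙ
    contra t<M = begin
      0ℙ                  ≡⟨ b-low i (s≤s (m∸n≤m q′ j)) ⟨
      b i                 ≡⟨ per i ⟨
      b (i + suc t)       ≡⟨ cong b i+t≡ ⟩
      b (suc u * q + 0)   ≡⟨ rows u 0 (≤-pred (m<n*o⇒m/o<n t<M)) (s≤s z≤n) ⟩
      1ℙ                  ∎

  ones : Σ[ weight ∘ b < suc M ] ≡ odds q + 1
  ones = begin
    Σ[ weight ∘ b < suc M ]
      ≡⟨ Σ-last (weight ∘ b) M ⟩
    Σ[ weight ∘ b < q + q * q ] + weight (b M)
      ≡⟨ cong₂ _+_ (Σ-+ (weight ∘ b) q (q * q)) (cong weight b-M) ⟩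
    Σ[ weight ∘ b < q ] + Σ[ (λ i → weight (b (q + i))) < q * q ] + 1
      -- The initial zeros contribute nothing, and the remaining q * q terms are cut into rows.
      ≡⟨ cong (_+ 1) (cong₂ _+_
           (trans (Σ-cong-< q (λ i i<q → cong weight (b-low i i<q))) (Σ-zero q))
           (Σ-* (λ i → weight (b (q + i))) q q)) ⟩
    Σ[ (λ k → Σ[ (λ j → weight (b (q + (k * q + j)))) < q ]) < q ] + 1
      ≡⟨ cong (_+ 1) (Σ-cong-< q (λ k k<q → Σ-cong-< q (λ j j<q →
           cong weight (trans (cong b (sym (+-assoc q (k * q) j))) (rows k j (<⇒≤ k<q) j<q))))) ⟩
    odds q + 1 ∎

-- The parity of the representation count.

module RepresentationParity
  (A : DigitSet) (p₀ : ℕ) (A-digits : elements A ≡ digits (suc p₀))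
  (pascal-q : ∀ j → 0 < j → j < double (suc p₀) → pascal (double (suc p₀)) j ≡ 0ℙ)
  where

  private
    p q N : ℕ
    p = suc p₀
    q = double p
    N = suc (suc q * q)

    0<p : 0 < p
    0<p = s≤s z≤n

    s b : ℕ → Parity
    s n = parity (f A n)
    b n = s n ⁻¹

    -- `f A n` unfolds to `reps (elements A) n n`, so only the digit list has to be rewritten.
    s≡ : ∀ n → s n ≡ parity (repCount p 0<p n)
    s≡ n = cong (λ xs → parity (reps xs n n)) A-digits

    parity-delay : ∀ d n → parity (delay 0 d (repCount p 0<p) n) ≡ delay 0ℙ d s n
    parity-delay d n = trans (delay-map parity 0 d (repCount p 0<p) n)
      (delay-cong d n (λ i _ → sym (s≡ i)))

    s-even : ∀ n → s (double n) ≡ s n ℙ.+ (delay 0ℙ p s n ℙ.+ delay 0ℙ (suc p) s n)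
    s-even n = begin
      s (double n)
        ≡⟨ trans (s≡ (double n)) (cong parity (repCount-even p 0<p n)) ⟩
      parity (c n + (delay 0 p c n + delay 0 (suc p) c n))
        ≡⟨ ℙ.+-homo-+ (c n) _ ⟩
      parity (c n) ℙ.+ parity (delay 0 p c n + delay 0 (suc p) c n)
        ≡⟨ cong₂ ℙ._+_ (sym (s≡ n)) (trans (ℙ.+-homo-+ (delay 0 p c n) _)
             (cong₂ ℙ._+_ (parity-delay p n) (parity-delay (suc p) n))) ⟩
      s n ℙ.+ (delay 0ℙ p s n ℙ.+ delay 0ℙ (suc p) s n) ∎
      where
      c : ℕ → ℕ
      c = repCount p 0<p

    s-odd : ∀ n → s (suc (double n)) ≡ s n
    s-odd n = trans (s≡ (suc (double n)))
      (trans (cong parity (repCount-odd p 0<p n)) (sym (s≡ n)))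

    -- The `refl` is `s 0 ≡ 1ℙ`: the empty word is the only word of length 0, and its value is 0.
    module S = SelfSimilar p s 0<p refl s-even s-odd

    -- Adding 1 to each of the three terms absorbs the constant, as 1 + 1 + 1 = 1, and makes the
    -- recurrence homogeneous.
    complement : ∀ x y z → x ℙ.+ (y ℙ.+ z) ≡ 1ℙ → x ⁻¹ ≡ y ⁻¹ ℙ.+ z ⁻¹
    complement 0ℙ 0ℙ 1ℙ _ = refl
    complement 0ℙ 1ℙ 0ℙ _ = refl
    complement 1ℙ 0ℙ 0ℙ _ = refl
    complement 1ℙ 1ℙ 1ℙ _ = refl

    module T = Trinomial (suc (double p₀)) b (s≤s (s≤s z≤n))
      (λ n n<q → cong _⁻¹ (S.low n n<q))
      (cong _⁻¹ S.at-q)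
      (λ i → complement (s (q + suc i)) (s (suc i)) (s i) (S.step i))
      pascal-q

  least-period : IsLeastPeriod (λ n → f A n % 2) N
  least-period =
      (s≤s z≤n , λ n → trans (n%2≡weight (f A (n + N)))
        (trans (cong weight (ℙ.⁻¹-injective (T.period n))) (sym (n%2≡weight (f A n)))))
    , λ { t (0<t , per) → T.no-shorter-period t 0<t (λ n → cong _⁻¹ (weight-injective
        (trans (sym (n%2≡weight (f A (n + t)))) (trans (per n) (n%2≡weight (f A n)))))) }

  evens : ∀ m → count (2 ∣?_) (consecutive (f A) m N) ≡ odds q + 1
  evens m = begin
    count (2 ∣?_) (consecutive (f A) m N)  ≡⟨ count-2∣ (λ i → f A (m + i)) N ⟩
    Σ[ (λ i → weight (b (m + i))) < N ]    ≡⟨ Σ-window (weight ∘ b) N (cong weight ∘ T.period) m ⟩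
    Σ[ weight ∘ b < N ]                    ≡⟨ T.ones ⟩
    odds q + 1                             ∎

-- Polynomials over the field of two elements.

coeff-+ : ∀ u v i → coeff (u +ₚ v) i ≡ coeff u i ℙ.+ coeff v i
coeff-+ []      v       i       = refl
coeff-+ (a ∷ u) []      i       = sym (ℙ.+-identityʳ _)
coeff-+ (a ∷ u) (b ∷ v) zero    = refl
coeff-+ (a ∷ u) (b ∷ v) (suc i) = coeff-+ u v i

+ₚ-assoc : ∀ u v w → (u +ₚ v) +ₚ w ≈ₚ u +ₚ (v +ₚ w)
+ₚ-assoc u v w i = begin
  coeff ((u +ₚ v) +ₚ w) i
    ≡⟨ trans (coeff-+ (u +ₚ v) w i) (cong (ℙ._+ coeff w i) (coeff-+ u v i)) ⟩
  (coeff u i ℙ.+ coeff v i) ℙ.+ coeff w i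
    ≡⟨ ℙ.+-assoc (coeff u i) (coeff v i) (coeff w i) ⟩
  coeff u i ℙ.+ (coeff v i ℙ.+ coeff w i)
    ≡⟨ trans (coeff-+ u (v +ₚ w) i) (cong (coeff u i ℙ.+_) (coeff-+ v w i)) ⟨
  coeff (u +ₚ (v +ₚ w)) i ∎

+ₚ-congˡ : ∀ u {v w} → v ≈ₚ w → u +ₚ v ≈ₚ u +ₚ w
+ₚ-congˡ u {v} {w} v≈w i = trans (coeff-+ u v i)
  (trans (cong (coeff u i ℙ.+_) (v≈w i)) (sym (coeff-+ u w i)))

+ₚ-identityʳ : ∀ u → u +ₚ 0ₚ ≡ u
+ₚ-identityʳ []      = refl
+ₚ-identityʳ (a ∷ u) = refl

-- `X ^ₚ 0` and `X ^ₚ 1` evaluate to `1ₚ` and `X`; it remains to drop the `0ₚ` that ends the fold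
-- and to reassociate to the left.
φ-𝒜 : ∀ r 3≤r → φ (𝒜 r 3≤r) ≈ₚ 1ₚ +ₚ X +ₚ X ^ₚ (2 ^ r) +ₚ X ^ₚ (2 ^ r + 2)
φ-𝒜 r 3≤r i = begin
  coeff (1ₚ +ₚ (X +ₚ (u +ₚ (v +ₚ 0ₚ)))) i
    ≡⟨ cong (λ w → coeff (1ₚ +ₚ (X +ₚ (u +ₚ w))) i) (+ₚ-identityʳ v) ⟩
  coeff (1ₚ +ₚ (X +ₚ (u +ₚ v))) i
    ≡⟨ +ₚ-assoc 1ₚ X (u +ₚ v) i ⟨
  coeff ((1ₚ +ₚ X) +ₚ (u +ₚ v)) i
    ≡⟨ +ₚ-assoc (1ₚ +ₚ X) u v i ⟨
  coeff (1ₚ +ₚ X +ₚ u +ₚ v) i ∎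
  where
  u v : 𝔽₂[X]
  u = X ^ₚ (2 ^ r)
  v = X ^ₚ (2 ^ r + 2)

-- Arithmetic of the period and the final count.

4^r≡2^r*2^r : ∀ r → 4 ^ r ≡ 2 ^ r * 2 ^ r
4^r≡2^r*2^r zero    = refl
4^r≡2^r*2^r (suc r) = trans (cong (4 *_) (4^r≡2^r*2^r r)) (square (2 ^ r))
  where
  square : ∀ x → 4 * (x * x) ≡ 2 * x * (2 * x)
  square = solve-∀

-- Odd and even terms together fill the window. As 3^r ≤ 4^r, the truncated subtraction is exact.
odd-count : ∀ {o e} r → o + e ≡ 4 ^ r + 2 ^ r + 1 → e ≡ 3 ^ r + 1 → o ≡ (4 ^ r ∸ 3 ^ r) + 2 ^ r
odd-count {o} r total refl = +-cancelʳ-≡ (3 ^ r + 1) o _ (begin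
  o + (3 ^ r + 1)
    ≡⟨ total ⟩
  4 ^ r + 2 ^ r + 1
    ≡⟨ cong (λ n → n + 2 ^ r + 1) (m∸n+n≡m (^-monoˡ-≤ r (n≤1+n 3))) ⟨
  (4 ^ r ∸ 3 ^ r) + 3 ^ r + 2 ^ r + 1
    ≡⟨ shuffle (4 ^ r ∸ 3 ^ r) (3 ^ r) (2 ^ r) ⟩
  (4 ^ r ∸ 3 ^ r) + 2 ^ r + (3 ^ r + 1) ∎)
  where
  shuffle : ∀ x y z → x + y + z + 1 ≡ x + z + (y + 1)
  shuffle = solve-∀

mainTheorem8 : (r : ℕ) (3≤r : 3 ≤ r) →
    φ (𝒜 r 3≤r) ≈ₚ 1ₚ +ₚ X +ₚ X ^ₚ (2 ^ r) +ₚ X ^ₚ (2 ^ r + 2)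
    × (∃[ p ] IsLeastPeriod (λ n → f (𝒜 r 3≤r) n % 2) p × p ∣ 4 ^ r + 2 ^ r + 1)
    × (∀ m →
    length (filter (λ t → ¬? (2 ∣? t)) (consecutive (f (𝒜 r 3≤r)) m (4 ^ r + 2 ^ r + 1)))
    ≡ (4 ^ r ∸ 3 ^ r) + 2 ^ r
    × length (filter (λ t → 2 ∣? t) (consecutive (f (𝒜 r 3≤r)) m (4 ^ r + 2 ^ r + 1)))
    ≡ 3 ^ r + 1)
mainTheorem8 r@(suc r′) 3≤r = φ-𝒜 r 3≤r
  -- The least period is the whole length, so divisibility is reflexive.
  , (4 ^ r + 2 ^ r + 1 , subst (IsLeastPeriod (λ n → f A n % 2)) N≡ P.least-period , ∣-refl)
  , λ m → odd-count r (trans (count-¬ (2 ∣?_) (window m)) (length-applyUpTo _ (4 ^ r + 2 ^ r + 1)))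
            (evens m)
        , evens m
  where
  A : DigitSet
  A = 𝒜 r 3≤r

  p₀ q : ℕ
  -- Half of 2^r is the positive number 2^(r - 1), written as `suc p₀` to fit the form of `digits`.
  p₀ = pred (2 ^ r′)
  q  = double (suc p₀)

  q≡2^r : q ≡ 2 ^ r
  q≡2^r = trans (cong double (suc-pred (2 ^ r′) {{m^n≢0 2 r′}})) (double≡2*n (2 ^ r′))

  A-digits : elements A ≡ digits (suc p₀)
  A-digits = cong₂ (λ x y → 0 ∷ 1 ∷ x ∷ y ∷ []) (sym q≡2^r)
    (trans (+-comm (2 ^ r) 2) (cong (2 +_) (sym q≡2^r)))

  module P = RepresentationParity A p₀ A-digits
    (subst (λ n → ∀ j → 0 < j → j < n → pascal n j ≡ 0ℙ) (sym q≡2^r) (pascal-2^r r))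

  N≡ : suc (suc q * q) ≡ 4 ^ r + 2 ^ r + 1
  N≡ = begin
    suc (suc q * q)              ≡⟨ cong (λ n → suc (suc n * n)) q≡2^r ⟩
    suc (2 ^ r + 2 ^ r * 2 ^ r)  ≡⟨ cong (λ n → suc (2 ^ r + n)) (4^r≡2^r*2^r r) ⟨
    suc (2 ^ r + 4 ^ r)          ≡⟨ cong suc (+-comm (2 ^ r) (4 ^ r)) ⟩
    suc (4 ^ r + 2 ^ r)          ≡⟨ +-comm 1 _ ⟩
    4 ^ r + 2 ^ r + 1            ∎

  window : ℕ → List ℕ
  window m = consecutive (f A) m (4 ^ r + 2 ^ r + 1)

  evens : ∀ m → count (2 ∣?_) (window m) ≡ 3 ^ r + 1
  evens m = begin
    count (2 ∣?_) (window m)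
      ≡⟨ cong (count (2 ∣?_) ∘ consecutive (f A) m) N≡ ⟨
    count (2 ∣?_) (consecutive (f A) m (suc (suc q * q)))
      ≡⟨ P.evens m ⟩
    odds q + 1
      ≡⟨ cong (_+ 1) (trans (cong odds q≡2^r) (odds-2^r r)) ⟩
    3 ^ r + 1 ∎
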